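{- Let $\alpha \leq \kappa(\mathfrak{Small})$ be a regular cardinal that is also a strong limit cardinal, and let $\mathfrak{J}_\alpha$ be a set of $\alpha$-small sets containing all $\alpha$-small cardinals. Let $(\Sigma,A)$ be a $\mathfrak{J}_\alpha$-ary algebra whose underlying set $A$ is $\alpha$-small. Then the following are equivalent: (1) the $\mathfrak{J}_\alpha$-ary double centralizer clone $(\Sigma^A)^{\perp\perp}$ is equal to the clone of $\mathfrak{J}_\alpha$-ary derived operations $\langle \Sigma^A\rangle_\alpha$; (2) for every $\mathfrak{J}_\alpha$-ary operation $f:A^J \rightarrow A$, if $f \notin \langle \Sigma^A\rangle_\alpha$ then there exists some $\Sigma$-homomorphism $h:A^{(A^J)} \rightarrow A$ such that $h(f) \neq f(h \circ u_J)$, where $u_J:J\to A^{(A^J)}$ is the map that sends each $j\in J$ to the projection $\pi_j:A^J\to A$.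
   Context: Fix a Grothendieck universe $\mathfrak{Small}$, i.e. the set of all sets of rank less than a fixed inaccessible cardinal $\kappa = \kappa(\mathfrak{Small})$; its elements are called small sets. Let $\alpha \leq \kappa(\mathfrak{Small})$ be an (infinite) regular cardinal. It is a strong limit cardinal if $2^\beta<\alpha$ for every cardinal $\beta<\alpha$. A set is $\alpha$-small if it is small and has cardinality less than $\alpha$. Fix a set $\mathfrak{J}_\alpha$ of sets with $\mathfrak{Card}_\alpha \subseteq \mathfrak{J}_\alpha \subseteq \mathfrak{Small}_\alpha$, where $\mathfrak{Card}_\alpha$ is the set of all $\alpha$-small cardinals and $\mathfrak{Small}_\alpha$ is the set of all $\alpha$-small sets. Given a set $A$, a $\mathfrak{J}_\alpha$-ary operation on $A$ is a map $A^J \to A$ with $J \in \mathfrak{J}_\alpha$ (its arity); nullary operations are allowed. A $\mathfrak{J}_\alpha$-ary signature is a (possibly large) set $\Sigma$ with an assignment of an arity in $\mathfrak{J}_\alpha$ to each $\sigma\in\Sigma$. A $\Sigma$-algebra is a set $A$ equipped with an operation $\sigma^A:A^J\to A$ for each $\sigma\in\Sigma$, where $J$ is the arity of $\sigma$; a $\Sigma$-homomorphism is a map preserving these basic operations. A $\mathfrak{J}_\alpha$-ary algebra is a pair $(\Sigma,A)$ of a $\mathfrak{J}_\alpha$-ary signature $\Sigma$ and a $\Sigma$-algebra $A$; write $\Sigma^A=\{\sigma^A\mid\sigma\in\Sigma\}$. Each power $A^Y$ is a $\Sigma$-algebra under the pointwise operations; in particular $A^{(A^J)}$ is a $\Sigma$-algebra.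 A $\mathfrak{J}_\alpha$-ary clone on $A$ is a set $F$ of $\mathfrak{J}_\alpha$-ary operations on $A$ that contains all projections $\pi_j:A^J\to A$ ($J\in\mathfrak{J}_\alpha$, $j\in J$) and is such that for all $J,K\in\mathfrak{J}_\alpha$, every $f:A^K\to A$ in $F$ and every family $g_k:A^J\to A$ $(k\in K)$ in $F$, the composite $f\circ(g_k)_{k\in K}:A^J\to A$ lies in $F$. The clone of $\mathfrak{J}_\alpha$-ary derived operations $\langle\Sigma^A\rangle_\alpha$ of $(\Sigma,A)$ is the smallest $\mathfrak{J}_\alpha$-ary clone on $A$ containing $\Sigma^A$. Operations $f:A^X\to A$ and $g:A^Y\to A$ commute, written $f\perp g$, if for every matrix $a=(a_{xy})\in A^{X\times Y}$ one has $g\bigl((f((a_{xy})_{x\in X}))_{y\in Y}\bigr)=f\bigl((g((a_{xy})_{y\in Y}))_{x\in X}\bigr)$. For a set $G$ of $\mathfrak{J}_\alpha$-ary operations on $A$, $G^\perp$ is the set of all $\mathfrak{J}_\alpha$-ary operations $f$ on $A$ with $f\perp g$ for all $g\in G$, and $G^{\perp\perp}=(G^\perp)^\perp$. In $h(f)$, the map $f:A^J\to A$ is regarded as an element of $A^{(A^J)}$; and $h\circ u_J:J\to A$ is regarded as an element of $A^J$. -}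

module Defs where

open import Level using (Level; _⊔_; suc; Lift)
open import Data.Bool.Base using (Bool)
open import Data.Empty.Polymorphic using (⊥; ⊥-elim)
open import Data.Maybe.Base using (Maybe; maybe)
open import Data.Nat.Base using (ℕ; zero) renaming (suc to 1+)
open import Data.Product.Base using (Σ; Σ-syntax; _×_; _,_; proj₁; proj₂)
open import Data.Product.Relation.Binary.Pointwise.NonDependent using (_×ₛ_)
open import Data.Sum.Base using (_⊎_)
open import Function.Bundles using (Func; _⟨$⟩_; Bijection; _⇔_)
open import Function.Construct.Composition using () renaming (function to compose)
open import Function.Relation.Binary.Setoid.Equality using (_⇨_)
open import Relation.Binary.Bundles using (Setoid)
open import Relation.Binary.PropositionalEquality.Properties using (setoid)
open import Relation.Nullary.Negation.Core using (¬_)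

private
  variable
    ℓ p q : Level

-- The ambient set theory is interpreted in the cumulative
-- hierarchy of well-founded trees, with extensional equality.

data V (ℓ : Level) : Set (suc ℓ) where
  sup : (I : Set ℓ) → (I → V ℓ) → V ℓ

Index : V ℓ → Set ℓ
Index (sup I _) = I

elem : (x : V ℓ) → Index x → V ℓ
elem (sup _ f) = f

infix 4 _≐_ _∈_ _⊆_

_≐_ : V ℓ → V ℓ → Set ℓ
sup I f ≐ sup J g = (∀ i → Σ[ j ∈ J ] f i ≐ g j) × (∀ j → Σ[ i ∈ I ] f i ≐ g j)

_∈_ : V ℓ → V ℓ → Set ℓ
x ∈ y = Σ[ i ∈ Index y ] x ≐ elem y i

_⊆_ : V ℓ → V ℓ → Set (suc ℓ)
x ⊆ y = ∀ z → z ∈ x → z ∈ y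

≐-refl : (x : V ℓ) → x ≐ x
≐-refl (sup _ f) = (λ i → i , ≐-refl (f i)) , (λ i → i , ≐-refl (f i))

≐-sym : (x y : V ℓ) → x ≐ y → y ≐ x
≐-sym (sup _ f) (sup _ g) (l , r) =
  (λ j → proj₁ (r j) , ≐-sym (f (proj₁ (r j))) (g j) (proj₂ (r j))) ,
  (λ i → proj₁ (l i) , ≐-sym (f i) (g (proj₁ (l i))) (proj₂ (l i)))

≐-trans : (x y z : V ℓ) → x ≐ y → y ≐ z → x ≐ z
≐-trans (sup _ f) (sup _ g) (sup _ h) (l , r) (l′ , r′) =
  (λ i → let j = proj₁ (l i) ; k = proj₁ (l′ j) in
         k , ≐-trans (f i) (g j) (h k) (proj₂ (l i)) (proj₂ (l′ j))) ,
  (λ k → let j = proj₁ (r′ k) ; i = proj₁ (r j) in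
         i , ≐-trans (f i) (g j) (h k) (proj₂ (r j)) (proj₂ (r′ k)))

-- A tree may list the same element more than once, so the elements of a
-- set form a setoid.  Maps between sets are maps of these setoids
-- (Func), and the power Aˣ is the setoid El x ⇨ El A.

El : V ℓ → Setoid ℓ ℓ
El x = record
  { Carrier = Index x
  ; _≈_ = λ i j → elem x i ≐ elem x j
  ; isEquivalence = record
    { refl  = λ {i} → ≐-refl (elem x i)
    ; sym   = λ {i} {j} → ≐-sym (elem x i) (elem x j)
    ; trans = λ {i} {j} {k} → ≐-trans (elem x i) (elem x j) (elem x k)
    }
  }

∅ : V ℓ
∅ = sup ⊥ ⊥-elim

-- x ∪ {x}
succ : V ℓ → V ℓ
succ x = sup (Maybe (Index x)) (maybe (elem x) x)

⋃ : V ℓ → V ℓ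
⋃ x = sup (Σ[ i ∈ Index x ] Index (elem x i)) (λ (i , j) → elem (elem x i) j)

rank : V ℓ → V ℓ
rank (sup I f) = ⋃ (sup I (λ i → succ (rank (f i))))

nat : ℕ → V ℓ
nat zero   = ∅
nat (1+ n) = succ (nat n)

ω : V ℓ
ω {ℓ} = sup (Lift ℓ ℕ) (λ n → nat (Level.lower n))

TransitiveSet : V ℓ → Set (suc ℓ)
TransitiveSet x = ∀ y → y ∈ x → y ⊆ x

-- Foundation is built into V, so a transitive set of transitive sets is
-- well-ordered by ∈.  The order β < α of ordinals is β ∈ α.
Ordinal : V ℓ → Set (suc ℓ)
Ordinal x = TransitiveSet x × (∀ y → y ∈ x → TransitiveSet y)

_≤ᵒ_ : V ℓ → V ℓ → Set ℓ
α ≤ᵒ β = α ∈ β ⊎ α ≐ β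

Cardinal : V ℓ → Set (suc ℓ)
Cardinal c = Ordinal c × (∀ β → β ∈ c → ¬ Bijection (El β) (El c))

-- The cardinal of the setoid X is less than α.
∣_∣<_ : Setoid p q → V ℓ → Set (p ⊔ q ⊔ suc ℓ)
∣_∣<_ {ℓ = ℓ} X α = Σ[ c ∈ V ℓ ] (Cardinal c × c ∈ α × Bijection X (El c))

-- An infinite cardinal with no cofinal map from a smaller ordinal.
record Regular (α : V ℓ) : Set (suc ℓ) where
  field
    cardinal : Cardinal α
    infinite : ω ⊆ α
    bounded  : ∀ β → β ∈ α → (f : Func (El β) (El α)) →
               Σ[ γ ∈ V ℓ ] (γ ∈ α × (∀ i → elem α (f ⟨$⟩ i) ∈ γ))

-- The cardinal 2^β is that of the set of maps β → Bool.
record StrongLimit (α : V ℓ) : Set (suc ℓ) where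
  field
    cardinal : Cardinal α
    limit    : ∀ β → Cardinal β → β ∈ α → ∣ El β ⇨ setoid Bool ∣< α

record Inaccessible (κ : V ℓ) : Set (suc ℓ) where
  field
    regular     : Regular κ
    strongLimit : StrongLimit κ
    uncountable : ω ∈ κ

-- Membership in the Grothendieck universe of sets of rank less than κ.
Small : (κ : V ℓ) → V ℓ → Set ℓ
Small κ x = rank x ∈ κ

record [_,_]-Small (κ α x : V ℓ) : Set (suc ℓ) where
  field
    small : Small κ x
    card< : ∣ El x ∣< α

infix 4 _≋_
_≋_ : {X Y : Setoid ℓ ℓ} → Func X Y → Func X Y → Set ℓ
_≋_ {X = X} {Y = Y} = Setoid._≈_ (X ⇨ Y)

module _ {A : Setoid ℓ ℓ} where

  -- f ∘ (gₖ)ₖ, that is y ↦ f (k ↦ gₖ y).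
  infixr 9 _∘⟨_⟩
  _∘⟨_⟩ : {K Y : Setoid ℓ ℓ} → Func (K ⇨ A) A → Func K (Y ⇨ A) → Func Y A
  _∘⟨_⟩ f g = record
    { to = λ y → f ⟨$⟩ record
        { to   = λ k → (g ⟨$⟩ k) ⟨$⟩ y
        ; cong = λ k≈k′ → Func.cong g k≈k′ y
        }
    ; cong = λ y≈y′ → Func.cong f (λ k → Func.cong (g ⟨$⟩ k) y≈y′)
    }

  projections : (J : Setoid ℓ ℓ) → Func J ((J ⇨ A) ⇨ A)
  projections J = record
    { to = λ j → record
        { to   = λ a → a ⟨$⟩ j
        ; cong = λ a≈b → a≈b j
        }
    ; cong = λ j≈j′ a → Func.cong a j≈j′
    }

  module _ {X Y : Setoid ℓ ℓ} where

    rows : Func (X ×ₛ Y) A → Func X (Y ⇨ A)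
    rows a = record
      { to = λ x → record
          { to   = λ y → a ⟨$⟩ (x , y)
          ; cong = λ y≈y′ → Func.cong a (Setoid.refl X , y≈y′)
          }
      ; cong = λ x≈x′ y → Func.cong a (x≈x′ , Setoid.refl Y)
      }

    columns : Func (X ×ₛ Y) A → Func Y (X ⇨ A)
    columns a = record
      { to = λ y → record
          { to   = λ x → a ⟨$⟩ (x , y)
          ; cong = λ x≈x′ → Func.cong a (x≈x′ , Setoid.refl Y)
          }
      ; cong = λ y≈y′ x → Func.cong a (Setoid.refl X , y≈y′)
      }

    Commutes : Func (X ⇨ A) A → Func (Y ⇨ A) A → Set ℓ
    Commutes f g = (a : Func (X ×ₛ Y) A) →
      Setoid._≈_ A (g ⟨$⟩ (f ∘⟨ rows a ⟩)) (f ⟨$⟩ (g ∘⟨ columns a ⟩))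

record Arity (𝔍 : V ℓ) : Set (suc ℓ) where
  constructor arity
  field
    set    : V ℓ
    member : set ∈ 𝔍

Els : {𝔍 : V ℓ} → Arity 𝔍 → Setoid ℓ ℓ
Els J = El (Arity.set J)

Operation : {𝔍 : V ℓ} → Setoid ℓ ℓ → Arity 𝔍 → Set ℓ
Operation A J = Func (Els J ⇨ A) A

OperationSet : V ℓ → Setoid ℓ ℓ → (p : Level) → Set (suc ℓ ⊔ suc p)
OperationSet 𝔍 A p = (J : Arity 𝔍) → Operation A J → Set p

module _ {𝔍 : V ℓ} {A : Setoid ℓ ℓ} where

  infix 3 _≗_
  _≗_ : OperationSet 𝔍 A p → OperationSet 𝔍 A q → Set (suc ℓ ⊔ p ⊔ q)
  F ≗ G = ∀ J f → F J f ⇔ G J f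

  -- Invariance under replacing the arity by an extensionally equal one
  -- follows from projection and composite.
  record IsClone (F : OperationSet 𝔍 A p) : Set (suc ℓ ⊔ p) where
    field
      respects   : ∀ {J} {f f′ : Operation A J} → f ≋ f′ → F J f → F J f′
      projection : ∀ J j → F J (projections (Els J) ⟨$⟩ j)
      composite  : ∀ {J K} {f : Operation A K} (g : Func (Els K) ((Els J ⇨ A) ⇨ A)) →
                   F K f → (∀ k → F J (g ⟨$⟩ k)) → F J (f ∘⟨ g ⟩)

  data ⟨_⟩ (B : OperationSet 𝔍 A p) : OperationSet 𝔍 A (suc ℓ ⊔ p) where
    generator  : ∀ {J f} → B J f → ⟨ B ⟩ J f
    respects   : ∀ {J} {f f′ : Operation A J} → f ≋ f′ → ⟨ B ⟩ J f → ⟨ B ⟩ J f′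
    projection : ∀ J j → ⟨ B ⟩ J (projections (Els J) ⟨$⟩ j)
    composite  : ∀ {J K} {f : Operation A K} (g : Func (Els K) ((Els J ⇨ A) ⇨ A)) →
                 ⟨ B ⟩ K f → (∀ k → ⟨ B ⟩ J (g ⟨$⟩ k)) → ⟨ B ⟩ J (f ∘⟨ g ⟩)

  ⟨⟩-isClone : (B : OperationSet 𝔍 A p) → IsClone ⟨ B ⟩
  ⟨⟩-isClone B = record
    { respects = respects ; projection = projection ; composite = composite }

  ⟨⟩-least : (B : OperationSet 𝔍 A p) (F : OperationSet 𝔍 A q) → IsClone F →
             (∀ {J f} → B J f → F J f) → ∀ {J f} → ⟨ B ⟩ J f → F J f
  ⟨⟩-least B F clone B⊆F = go
    where
    module F = IsClone clone
    go : ∀ {J f} → ⟨ B ⟩ J f → F J f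
    go (generator b)      = B⊆F b
    go (respects e d)     = F.respects e (go d)
    go (projection J j)   = F.projection J j
    go (composite g d ds) = F.composite g (go d) (λ k → go (ds k))

  infix 30 _^⊥
  _^⊥ : OperationSet 𝔍 A p → OperationSet 𝔍 A (suc ℓ ⊔ p)
  (G ^⊥) J f = ∀ K (g : Operation A K) → G K g → Commutes f g

-- Signatures may be large: Symbol need not be indexed by a set in V ℓ.
record Signature (𝔍 : V ℓ) : Set (suc (suc ℓ)) where
  field
    Symbol : Set (suc ℓ)
    ar     : Symbol → Arity 𝔍

record Algebra {𝔍 : V ℓ} (𝕊 : Signature 𝔍) (A : Setoid ℓ ℓ) : Set (suc ℓ) where
  open Signature 𝕊
  field
    op : (σ : Symbol) → Operation A (ar σ)

module _ {𝔍 : V ℓ} {𝕊 : Signature 𝔍} where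
  open Signature 𝕊
  open Algebra

  data BasicOperations {A : Setoid ℓ ℓ} (𝒜 : Algebra 𝕊 A) : OperationSet 𝔍 A (suc ℓ) where
    basic : ∀ σ {f} → op 𝒜 σ ≋ f → BasicOperations 𝒜 (ar σ) f

  Power : {A : Setoid ℓ ℓ} → Algebra 𝕊 A → (Y : Setoid ℓ ℓ) → Algebra 𝕊 (Y ⇨ A)
  op (Power 𝒜 Y) σ = record
    { to   = λ a → op 𝒜 σ ∘⟨ a ⟩
    ; cong = λ a≈b y → Func.cong (op 𝒜 σ) (λ j → a≈b j y)
    }

  record Homomorphism {A B : Setoid ℓ ℓ} (𝒜 : Algebra 𝕊 A) (ℬ : Algebra 𝕊 B) : Set (suc ℓ) where
    field
      map       : Func A B
      preserves : ∀ σ (a : Func (Els (ar σ)) A) →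
                  Setoid._≈_ B (map ⟨$⟩ (op 𝒜 σ ⟨$⟩ a)) (op ℬ σ ⟨$⟩ compose a map)

{-# OPTIONS --safe #-}

-- The centralizer G^⊥ of any G is a clone, so ⟨Σ⟩ ⊆ Σ^⊥⊥ always holds, and
-- both conditions say that Σ^⊥⊥ ⊆ ⟨Σ⟩.  If f ∉ Σ^⊥⊥, some g ∈ Σ^⊥ of arity K
-- fails to commute with f on a matrix a, and φ ↦ g (k ↦ φ (aₖ)) is a
-- homomorphism separating f from the projections.  Conversely, a separating
-- homomorphism h : A^(A^J) → A is an element of Σ^⊥ not commuting with f, once
-- A^J is identified with an arity in 𝔍, that is, with an α-small cardinal.  The
-- strong limit hypothesis makes A^J α-small: an operation is determined by its
-- graph, and Kuratowski pairs embed products in double power sets.  A set that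
-- embeds in an ordinal c collapses to an ordinal ≤ c, so its cardinal is at most c.

module Submission where

open import Level using (Level; suc; Lift; lift; lower)
open import Axiom.ExcludedMiddle using (ExcludedMiddle)
open import Axiom.DoubleNegationElimination using (em⇒dne)
open import Data.Bool.Base using (Bool)
open import Data.Maybe.Base using (just; nothing)
open import Data.Product.Base using (Σ-syntax; _×_; _,_; proj₁; proj₂; swap)
open import Data.Product.Relation.Binary.Pointwise.NonDependent using (_×ₛ_)
open import Data.Sum.Base using (_⊎_; inj₁; inj₂)
open import Function.Base using (_∘_)
open import Function.Bundles
  using (Func; _⟨$⟩_; Injection; Bijection; Inverse; Equivalence; _⇔_; mk⇔)
open import Function.Properties.Inverse using (Inverse⇒Bijection) renaming (sym to inverse-sym)
import Function.Construct.Composition as Composition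
open import Function.Construct.Composition using () renaming (function to compose)
open import Function.Properties.Bijection as Bijection using (Bijection⇒Inverse)
open import Function.Relation.Binary.Setoid.Equality using (_⇨_)
open import Relation.Binary.Bundles using (Setoid)
open import Relation.Binary.PropositionalEquality.Core as ≡ using (_≡_)
open import Relation.Binary.PropositionalEquality.Properties using (setoid)
open import Relation.Nullary.Decidable.Core using (Dec; yes; no; does; map′)
open import Relation.Nullary.Decidable using (does-⇔)
open import Relation.Nullary.Negation.Core using (¬_; contradiction)
open import Defs

private
  variable
    ℓ p q r s : Level

-- Sets and ordinals

∈-elem : (x : V ℓ) (i : Index x) → elem x i ∈ x
∈-elem x i = i , ≐-refl (elem x i)

∈-respˡ : (x y z : V ℓ) → x ≐ y → y ∈ z → x ∈ z
∈-respˡ x y z x≐y (i , y≐) = i , ≐-trans x y (elem z i) x≐y y≐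

≐⇒⊆ : (x y : V ℓ) → x ≐ y → x ⊆ y
≐⇒⊆ (sup I f) (sup J g) (l , _) z (i , z≐) =
  proj₁ (l i) , ≐-trans z (f i) (g (proj₁ (l i))) z≐ (proj₂ (l i))

extensionality : (x y : V ℓ) → x ⊆ y → y ⊆ x → x ≐ y
extensionality (sup I f) (sup J g) x⊆y y⊆x =
  (λ i → x⊆y (f i) (∈-elem (sup I f) i)) ,
  (λ j → let i , e = y⊆x (g j) (∈-elem (sup J g) j) in i , ≐-sym (g j) (f i) e)

-- If `x` equals its element `f i`, then `f i ∈ x` gives `f i ∈ f i`, a smaller tree to recurse on.
∈-irrefl : (x : V ℓ) → ¬ (x ∈ x)
∈-irrefl (sup I f) (i , x≐fi) =
  ∈-irrefl (f i) (≐⇒⊆ (sup I f) (f i) x≐fi (f i) (∈-elem (sup I f) i))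

∈-ordinal : (x y : V ℓ) → Ordinal x → y ∈ x → Ordinal y
∈-ordinal x y (tr , trs) y∈x = trs y y∈x , λ z z∈y → trs z (tr y y∈x z z∈y)

elem-ordinal : (x : V ℓ) → Ordinal x → (i : Index x) → Ordinal (elem x i)
elem-ordinal x ox i = ∈-ordinal x (elem x i) ox (∈-elem x i)

∈-succ⁻ : (x z : V ℓ) → z ∈ succ x → z ∈ x ⊎ z ≐ x
∈-succ⁻ x z (just i , z≐) = inj₁ (i , z≐)
∈-succ⁻ x z (nothing , z≐) = inj₂ z≐

-- Needed to see that ordinals in κ are small sets. By induction `rank x` is the union of the
-- successors of the elements of `x`, and transitivity keeps these successors inside `x`.
rank-ordinal : (x : V ℓ) → Ordinal x → rank x ≐ x
rank-ordinal (sup I f) ox@(tr , _) = extensionality (rank x) x to from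
  where
  x : V _
  x = sup I f

  ih : ∀ i → rank (f i) ≐ f i
  ih i = rank-ordinal (f i) (elem-ordinal x ox i)

  to : rank x ⊆ x
  to z ((i , k) , z≐) with ∈-succ⁻ (rank (f i)) z (k , z≐)
  ... | inj₁ z∈ = tr (f i) (∈-elem x i) z (≐⇒⊆ (rank (f i)) (f i) (ih i) z z∈)
  ... | inj₂ e  = i , ≐-trans z (rank (f i)) (f i) e (ih i)

  from : x ⊆ rank x
  from z (i , z≐) = (i , nothing) ,
    ≐-trans z (f i) (rank (f i)) z≐ (≐-sym (rank (f i)) (f i) (ih i))

-- Maps into a set, given by their values.

module _ (X : Setoid ℓ ℓ) (z : V ℓ) (g : Setoid.Carrier X → V ℓ) where
  open Setoid X

  -- Points of `El z` are indices, so the index is read off the proof that `g x ∈ z`, and `e`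
  -- transfers the properties of `g` to it.
  injectionInto : (∀ {x y} → x ≈ y → g x ≐ g y) → (∀ {x y} → g x ≐ g y → x ≈ y) →
                  (∀ x → g x ∈ z) → Injection X (El z)
  injectionInto g-cong g-injective g∈z = record
    { to        = λ x → proj₁ (g∈z x)
    ; cong      = λ {x} {y} x≈y →
        ≐-trans (h x) (g x) (h y) (≐-sym (g x) (h x) (e x))
          (≐-trans (g x) (g y) (h y) (g-cong x≈y) (e y))
    ; injective = λ {x} {y} hx≐hy →
        g-injective (≐-trans (g x) (h x) (g y) (e x)
          (≐-trans (h x) (h y) (g y) hx≐hy (≐-sym (g y) (h y) (e y))))
    }
    where
    h : Carrier → V ℓ
    h x = elem z (proj₁ (g∈z x))
    e : ∀ x → g x ≐ h x
    e x = proj₂ (g∈z x)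

  bijectionOnto : (∀ {x y} → x ≈ y → g x ≐ g y) → (∀ {x y} → g x ≐ g y → x ≈ y) →
                  (∀ x → g x ∈ z) → (∀ u → u ∈ z → Σ[ x ∈ Carrier ] u ≐ g x) →
                  Bijection X (El z)
  bijectionOnto g-cong g-injective g∈z covers = record
    { to        = I.to
    ; cong      = I.cong
    ; bijective = I.injective , λ i →
        let x , u≐ = covers (elem z i) (∈-elem z i) in
        x , λ {y} y≈x → Setoid.trans (El z) {I.to y} {I.to x} {i} (I.cong y≈x)
          (≐-sym (elem z i) (elem z (I.to x))
            (≐-trans (elem z i) (g x) (elem z (I.to x)) u≐ (proj₂ (g∈z x))))
    }
    where module I = Injection (injectionInto g-cong g-injective g∈z)

⊆⇒Injection : (x y : V ℓ) → x ⊆ y → Injection (El x) (El y)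
⊆⇒Injection x y x⊆y =
  injectionInto (El x) y (elem x) (λ e → e) (λ e → e) (λ i → x⊆y (elem x i) (∈-elem x i))

≐⇒Bijection : (x y : V ℓ) → x ≐ y → Bijection (El x) (El y)
≐⇒Bijection x y x≐y =
  bijectionOnto (El x) y (elem x) (λ e → e) (λ e → e)
    (λ i → ≐⇒⊆ x y x≐y (elem x i) (∈-elem x i))
    (≐⇒⊆ y x (≐-sym x y x≐y))

-- The Mostowski collapse of membership restricted to a subclass `P`.

module Collapse (P : V ℓ → Set ℓ) (P-resp : ∀ x y → x ≐ y → P x → P y) where

  collapse : V ℓ → V ℓ
  collapse (sup I f) = sup (Σ[ i ∈ I ] P (f i)) (λ (i , _) → collapse (f i))

  collapse-cong : ∀ x y → x ≐ y → collapse x ≐ collapse y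
  collapse-cong (sup I f) (sup J g) (l , r) =
    (λ (i , pi) → let j , e = l i in (j , P-resp (f i) (g j) e pi) , collapse-cong (f i) (g j) e) ,
    (λ (j , pj) → let i , e = r j in
      (i , P-resp (g j) (f i) (≐-sym (f i) (g j) e) pj) , collapse-cong (f i) (g j) e)

  ∈-collapse⁺ : ∀ x y → y ∈ x → P y → collapse y ∈ collapse x
  ∈-collapse⁺ (sup I f) y (i , y≐) py = (i , P-resp y (f i) y≐ py) , collapse-cong y (f i) y≐

  ∈-collapse⁻ : ∀ x z → z ∈ collapse x → Σ[ y ∈ V ℓ ] (y ∈ x × P y × z ≐ collapse y)
  ∈-collapse⁻ (sup I f) z ((i , pi) , z≐) = f i , ∈-elem (sup I f) i , pi , z≐

  -- An element of an element of `collapse x` has the form `collapse v` with `P v` and `v ∈ w ∈ x`,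
  -- and transitivity of `x` gives `v ∈ x`.
  collapse-transitive : ∀ x → TransitiveSet x → TransitiveSet (collapse x)
  collapse-transitive x tr y y∈ z z∈y =
    let w , w∈x , _  , y≐ = ∈-collapse⁻ x y y∈
        v , v∈w , pv , z≐ = ∈-collapse⁻ w z (≐⇒⊆ y (collapse w) y≐ z z∈y)
    in ∈-respˡ z (collapse v) (collapse x) z≐ (∈-collapse⁺ x v (tr w w∈x v v∈w) pv)

  collapse-ordinal : ∀ x → Ordinal x → Ordinal (collapse x)
  collapse-ordinal x (tr , trs) = collapse-transitive x tr , λ y y∈ z z∈y u u∈z →
    let w , w∈x , _ , y≐ = ∈-collapse⁻ x y y∈
        cw∋ = ≐⇒⊆ y (collapse w) y≐
    in ≐⇒⊆ (collapse w) y (≐-sym y (collapse w) y≐) u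
         (collapse-transitive w (trs w w∈x) z (cw∋ z z∈y) u u∈z)

  -- By descent: `x ≐ collapse (f i)` puts `f i` into `collapse (f i)`. Together with trichotomy,
  -- this bounds the collapse of an ordinal by the ordinal itself.
  ∉-collapse : ∀ x → ¬ (x ∈ collapse x)
  ∉-collapse (sup I f) ((i , _) , x≐) =
    ∉-collapse (f i) (≐⇒⊆ (sup I f) (collapse (f i)) x≐ (f i) (∈-elem (sup I f) i))

Cardinal⇒∣∣< : (α c : V ℓ) → Cardinal c → c ∈ α → ∣ El c ∣< α
Cardinal⇒∣∣< α c card c∈α = c , card , c∈α , Bijection.refl

-- Power sets and cardinality

precompose : {X : Setoid p q} {Y : Setoid r s} (Z : Setoid ℓ ℓ) → Bijection X Y → Bijection (X ⇨ Z) (Y ⇨ Z)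
precompose {X = X} {Y} Z b = record
  { to        = λ f → compose from f
  ; cong      = λ f≈g y → f≈g (I.from y)
  ; bijective =
      (λ {f} {g} eq x → Z.trans (Func.cong f (X.sym (I.strictlyInverseʳ x)))
         (Z.trans (eq (I.to x)) (Func.cong g (I.strictlyInverseʳ x)))) ,
      (λ g → compose to g , λ eq y → Z.trans (eq (I.from y)) (Func.cong g (I.strictlyInverseˡ y)))
  }
  where
  module I = Inverse (Bijection⇒Inverse b)
  module X = Setoid X
  module Z = Setoid Z
  to : Func X Y
  to = record { to = I.to ; cong = I.to-cong }
  from : Func Y X
  from = record { to = I.from ; cong = I.from-cong }

𝟚 : Setoid _ _
𝟚 = setoid Bool

does-≡⇒ : {P : Set p} {Q : Set q} (p? : Dec P) (q? : Dec Q) → does p? ≡ does q? → P → Q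
does-≡⇒ _       (yes y) _ _ = y
does-≡⇒ (no ¬x) (no _)  _ x = contradiction x ¬x

module Classical {ℓ : Level} (em⁺ : ExcludedMiddle (suc ℓ)) where

  em : ExcludedMiddle ℓ
  em {P} = map′ lower lift (em⁺ {Lift (suc ℓ) P})

  -- Comparison of ordinals.

  Trichotomous : V ℓ → V ℓ → Set ℓ
  Trichotomous x y = x ∈ y ⊎ x ≐ y ⊎ y ∈ x

  -- If neither x nor y is (an element of) an element of the other, each contains
  -- all elements of the other.
  trichotomy-step : {I J : Set ℓ} (f : I → V ℓ) (g : J → V ℓ) →
                    TransitiveSet (sup I f) → TransitiveSet (sup J g) →
                    (∀ i → Trichotomous (f i) (sup J g)) → (∀ j → Trichotomous (sup I f) (g j)) →
                    Trichotomous (sup I f) (sup J g)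
  trichotomy-step {I} {J} f g trx try tri-x tri-y
    with em {Σ[ i ∈ I ] (f i ≐ sup J g ⊎ sup J g ∈ f i)}
       | em {Σ[ j ∈ J ] (sup I f ∈ g j ⊎ sup I f ≐ g j)}
  ... | yes (i , inj₁ e) | _ = inj₂ (inj₂ (i , ≐-sym (f i) (sup J g) e))
  ... | yes (i , inj₂ m) | _ = inj₂ (inj₂ (trx (f i) (∈-elem (sup I f) i) (sup J g) m))
  ... | no _ | yes (j , inj₁ m) = inj₁ (try (g j) (∈-elem (sup J g) j) (sup I f) m)
  ... | no _ | yes (j , inj₂ e) = inj₁ (j , e)
  ... | no ¬x | no ¬y = inj₂ (inj₁ (extensionality (sup I f) (sup J g)
          (λ z (i , e) → ∈-respˡ z (f i) (sup J g) e (below-y i))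
          (λ z (j , e) → ∈-respˡ z (g j) (sup I f) e (below-x j))))
    where
    below-y : ∀ i → f i ∈ sup J g
    below-y i with tri-x i
    ... | inj₁ m = m
    ... | inj₂ m = contradiction (i , m) ¬x
    below-x : ∀ j → g j ∈ sup I f
    below-x j with tri-y j
    ... | inj₁ m = contradiction (j , inj₁ m) ¬y
    ... | inj₂ (inj₁ e) = contradiction (j , inj₂ e) ¬y
    ... | inj₂ (inj₂ m) = m

  trichotomy : (x y : V ℓ) → Ordinal x → Ordinal y → Trichotomous x y
  trichotomy x@(sup I f) y@(sup J g) ox oy =
    trichotomy-step f g (proj₁ ox) (proj₁ oy)
      (λ i → trichotomy (f i) y (elem-ordinal x ox i) oy)
      (λ j → trichotomy x (g j) ox (elem-ordinal y oy j))

  module _ (P : V ℓ → Set ℓ) (P-resp : ∀ x y → x ≐ y → P x → P y) where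
    open Collapse P P-resp

    -- Unequal ordinals are comparable by membership, which the collapse preserves on `P`; equal
    -- collapses would then contradict irreflexivity.
    collapse-injective : ∀ x y → Ordinal x → Ordinal y → P x → P y →
                         collapse x ≐ collapse y → x ≐ y
    collapse-injective x y ox oy px py eq with trichotomy x y ox oy
    ... | inj₁ m = contradiction
      (∈-respˡ (collapse y) (collapse x) (collapse y) (≐-sym (collapse x) (collapse y) eq)
        (∈-collapse⁺ y x m px))
      (∈-irrefl (collapse y))
    ... | inj₂ (inj₁ e) = e
    ... | inj₂ (inj₂ m) = contradiction
      (∈-respˡ (collapse x) (collapse y) (collapse x) eq (∈-collapse⁺ x y m py))
      (∈-irrefl (collapse x))

  -- Characteristic functions, Kuratowski pairs and graphs.

  char : (X : Setoid ℓ ℓ) (P : Setoid.Carrier X → Set ℓ) →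
         (∀ {x y} → Setoid._≈_ X x y → P x → P y) → Func X 𝟚
  char X P resp = record
    { to   = λ x → does (em {P x})
    ; cong = λ x≈y → does-⇔ (mk⇔ (resp x≈y) (resp (Setoid.sym X x≈y))) em em
    }

  module _ (X : Setoid ℓ ℓ) where
    open Setoid X

    doubleton : Carrier → Carrier → Func X 𝟚
    doubleton a b = char X (λ x → x ≈ a ⊎ x ≈ b) λ where
      x≈y (inj₁ e) → inj₁ (trans (sym x≈y) e)
      x≈y (inj₂ e) → inj₂ (trans (sym x≈y) e)

    doubleton-cong : ∀ {a b c d} → a ≈ c → b ≈ d →
                     Setoid._≈_ (X ⇨ 𝟚) (doubleton a b) (doubleton c d)
    doubleton-cong a≈c b≈d x = does-⇔ (mk⇔
      (λ { (inj₁ e) → inj₁ (trans e a≈c) ; (inj₂ e) → inj₂ (trans e b≈d) })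
      (λ { (inj₁ e) → inj₁ (trans e (sym a≈c)) ; (inj₂ e) → inj₂ (trans e (sym b≈d)) })) em em

    doubleton-injective : ∀ {a b c d} → Setoid._≈_ (X ⇨ 𝟚) (doubleton a b) (doubleton c d) →
                          (a ≈ c × b ≈ d) ⊎ (a ≈ d × b ≈ c)
    doubleton-injective {a} {b} {c} {d} eq
      with does-≡⇒ em em (eq a) (inj₁ refl) | does-≡⇒ em em (eq b) (inj₂ refl)
         | does-≡⇒ em em (≡.sym (eq c)) (inj₁ refl) | does-≡⇒ em em (≡.sym (eq d)) (inj₂ refl)
    ... | inj₁ ac | inj₂ bd | _ | _ = inj₁ (ac , bd)
    ... | inj₂ ad | inj₁ bc | _ | _ = inj₂ (ad , bc)
    -- When `a` and `b` both match the same point, the remaining point is located by its own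
    -- membership in the doubleton of `a` and `b`.
    ... | inj₁ ac | inj₁ bc | _ | inj₁ da = inj₂ (sym da , bc)
    ... | inj₁ ac | inj₁ bc | _ | inj₂ db = inj₁ (ac , sym db)
    ... | inj₂ ad | inj₂ bd | inj₁ ca | _ = inj₁ (sym ca , bd)
    ... | inj₂ ad | inj₂ bd | inj₂ cb | _ = inj₂ (ad , sym cb)

    diagonal-injective : ∀ {a c d} → Setoid._≈_ (X ⇨ 𝟚) (doubleton a a) (doubleton c d) →
                         a ≈ c × a ≈ d
    diagonal-injective eq with doubleton-injective eq
    ... | inj₁ e = e
    ... | inj₂ e = swap e

  kuratowski : (X : Setoid ℓ ℓ) → Injection (X ×ₛ X) ((X ⇨ 𝟚) ⇨ 𝟚)
  kuratowski X = record
    { to        = λ (x , y) → doubleton (X ⇨ 𝟚) (doubleton X x x) (doubleton X x y)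
    ; cong      = λ { {x , y} {x′ , y′} (e , e′) → doubleton-cong (X ⇨ 𝟚)
        {doubleton X x x} {doubleton X x y} {doubleton X x′ x′} {doubleton X x′ y′}
        (doubleton-cong X e e) (doubleton-cong X e e′) }
    ; injective = λ {(x , y)} {(x′ , y′)} eq → injective x y x′ y′
        (doubleton-injective (X ⇨ 𝟚)
          {doubleton X x x} {doubleton X x y} {doubleton X x′ x′} {doubleton X x′ y′} eq)
    }
    where
    open Setoid X
    _≈₂_ : Func X 𝟚 → Func X 𝟚 → Set ℓ
    _≈₂_ = Setoid._≈_ (X ⇨ 𝟚)
    injective : ∀ x y x′ y′ →
      (doubleton X x x ≈₂ doubleton X x′ x′ × doubleton X x y ≈₂ doubleton X x′ y′) ⊎
      (doubleton X x x ≈₂ doubleton X x′ y′ × doubleton X x y ≈₂ doubleton X x′ x′) →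
      x ≈ x′ × y ≈ y′
    injective x y x′ y′ (inj₁ (xx , xy)) with diagonal-injective X xx | doubleton-injective X xy
    ... | _         | inj₁ e = e
    ... | x≈x′ , _ | inj₂ (x≈y′ , y≈x′) = x≈x′ , trans y≈x′ (trans (sym x≈x′) x≈y′)
    -- In the crossed case each singleton equals the other doubleton, so all four points coincide.
    injective x y x′ y′ (inj₂ (xx , xy)) =
      let x≈x′ , x≈y′ = diagonal-injective X xx
          _    , x′≈y = diagonal-injective X (Setoid.sym (X ⇨ 𝟚) {doubleton X x y} {doubleton X x′ x′} xy)
      in x≈x′ , trans (sym x′≈y) (trans (sym x≈x′) x≈y′)

  graph : (X Y : Setoid ℓ ℓ) → Injection (X ⇨ Y) ((X ×ₛ Y) ⇨ 𝟚)
  graph X Y = record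
    { to        = λ f → char (X ×ₛ Y) (λ (x , y) → f ⟨$⟩ x ≈ y)
        (λ (x≈x′ , y≈y′) e → trans (Func.cong f (Setoid.sym X x≈x′)) (trans e y≈y′))
    ; cong      = λ f≈g (x , y) →
        does-⇔ (mk⇔ (trans (sym (f≈g x))) (trans (f≈g x))) em em
    -- The graphs are compared at a point of the graph of `f`.
    ; injective = λ {f} {g} eq x → sym (does-≡⇒ em em (eq (x , f ⟨$⟩ x)) refl)
    }
    where open Setoid Y

  -- Closure properties of cardinality below a strong limit.

  module Cardinality (α : V ℓ) (strongLimit : StrongLimit α) where

    α-ordinal : Ordinal α
    α-ordinal = proj₁ (StrongLimit.cardinal strongLimit)

    -- Either no element of `x` is equinumerous with `x`, so that `x` is a cardinal, or the search
    -- descends to such an element, a subtree of `x`.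
    equinumerousCardinal : (x : V ℓ) → Ordinal x → x ∈ α → ∣ El x ∣< α
    equinumerousCardinal x@(sup I f) ox x∈α
      with em {Σ[ i ∈ I ] Bijection (El (f i)) (El x)}
    ... | no ¬b = Cardinal⇒∣∣< α x
      (ox , λ β (i , β≐) b → ¬b (i , Bijection.trans (≐⇒Bijection (f i) β (≐-sym β (f i) β≐)) b))
      x∈α
    ... | yes (i , b) =
      let c , card , c∈α , b′ = equinumerousCardinal (f i) (elem-ordinal x ox i)
            (proj₁ α-ordinal x x∈α (f i) (∈-elem x i))
      in c , card , c∈α , Bijection.trans (Inverse⇒Bijection (inverse-sym (Bijection⇒Inverse b))) b′

    -- `P` is the image of `X` in the cardinal `c` of `Y`. Collapsing `c` along `P` yields an
    -- ordinal in bijection with `X`, at most `c` and therefore in `α`.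
    injection⇒∣∣< : {X Y : Setoid ℓ ℓ} → Injection X Y → ∣ Y ∣< α → ∣ X ∣< α
    injection⇒∣∣< {X} {Y} j (c , (oc , _) , c∈α , b) =
      let k , card , k∈α , b′ = equinumerousCardinal (collapse c) (collapse-ordinal c oc) collapse∈α
      in k , card , k∈α , Bijection.trans X≅collapse b′
      where
      module I = Injection (Composition.injection j (Bijection.injection b))
      e : Setoid.Carrier X → V ℓ
      e x = elem c (I.to x)

      P : V ℓ → Set ℓ
      P z = Σ[ x ∈ Setoid.Carrier X ] z ≐ e x

      P-resp : ∀ z w → z ≐ w → P z → P w
      P-resp z w z≐w (x , z≐) = x , ≐-trans w z (e x) (≐-sym z w z≐w) z≐

      open Collapse P P-resp

      e-ordinal : ∀ x → Ordinal (e x)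
      e-ordinal x = elem-ordinal c oc (I.to x)

      e∈P : ∀ x → P (e x)
      e∈P x = x , ≐-refl (e x)

      X≅collapse : Bijection X (El (collapse c))
      X≅collapse = bijectionOnto X (collapse c) (collapse ∘ e)
        (λ {x} {y} x≈y → collapse-cong (e x) (e y) (I.cong x≈y))
        (λ {x} {y} eq → I.injective (collapse-injective P P-resp (e x) (e y)
          (e-ordinal x) (e-ordinal y) (e∈P x) (e∈P y) eq))
        (λ x → ∈-collapse⁺ c (e x) (∈-elem c (I.to x)) (e∈P x))
        (λ u u∈ → let z , _ , (x , z≐) , u≐ = ∈-collapse⁻ c u u∈ in
          x , ≐-trans u (collapse z) (collapse (e x)) u≐ (collapse-cong z (e x) z≐))

      collapse∈α : collapse c ∈ α
      collapse∈α with trichotomy (collapse c) c (collapse-ordinal c oc) oc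
      ... | inj₁ m = proj₁ α-ordinal c c∈α (collapse c) m
      ... | inj₂ (inj₁ m) = ∈-respˡ (collapse c) c α m c∈α
      ... | inj₂ (inj₂ m) = contradiction m (∉-collapse c)

    ∣⇨𝟚∣< : {X : Setoid ℓ ℓ} → ∣ X ∣< α → ∣ X ⇨ 𝟚 ∣< α
    ∣⇨𝟚∣< (c , card , c∈α , b) =
      let k , card′ , k∈α , b′ = StrongLimit.limit strongLimit c card c∈α
      in k , card′ , k∈α , Bijection.trans (precompose 𝟚 b) b′

    -- Kuratowski pairs require a common set: both factors embed in the larger cardinal `m`, and the
    -- square of `m` embeds in its double power set.
    ∣×∣< : {X Y : Setoid ℓ ℓ} → ∣ X ∣< α → ∣ Y ∣< α → ∣ X ×ₛ Y ∣< α
    ∣×∣< {X} {Y} (c , card-c , c∈α , bX) (d , card-d , d∈α , bY) =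
      let m , m<α , cm , dm = bound in
      injection⇒∣∣<
        (Composition.injection
          (pairs (Composition.injection (Bijection.injection bX) cm)
                 (Composition.injection (Bijection.injection bY) dm))
          (kuratowski (El m)))
        (∣⇨𝟚∣< (∣⇨𝟚∣< m<α))
      where
      pairs : {Z : Setoid ℓ ℓ} → Injection X Z → Injection Y Z → Injection (X ×ₛ Y) (Z ×ₛ Z)
      pairs f g = record
        { to        = λ (x , y) → Injection.to f x , Injection.to g y
        ; cong      = λ (e , e′) → Injection.cong f e , Injection.cong g e′
        ; injective = λ (e , e′) → Injection.injective f e , Injection.injective g e′
        }

      bound : Σ[ m ∈ V ℓ ] (∣ El m ∣< α × Injection (El c) (El m) × Injection (El d) (El m))
      bound with trichotomy c d (proj₁ card-c) (proj₁ card-d)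
      ... | inj₁ m = d , Cardinal⇒∣∣< α d card-d d∈α ,
        ⊆⇒Injection c d (proj₁ (proj₁ card-d) c m) , ⊆⇒Injection d d (λ _ z → z)
      ... | inj₂ (inj₁ e) = d , Cardinal⇒∣∣< α d card-d d∈α ,
        ⊆⇒Injection c d (≐⇒⊆ c d e) , ⊆⇒Injection d d (λ _ z → z)
      ... | inj₂ (inj₂ m) = c , Cardinal⇒∣∣< α c card-c c∈α ,
        ⊆⇒Injection c c (λ _ z → z) , ⊆⇒Injection d c (proj₁ (proj₁ card-c) d m)

    ∣⇨∣< : {X Y : Setoid ℓ ℓ} → ∣ X ∣< α → ∣ Y ∣< α → ∣ X ⇨ Y ∣< α
    ∣⇨∣< {X} {Y} X<α Y<α = injection⇒∣∣< (graph X Y) (∣⇨𝟚∣< (∣×∣< X<α Y<α))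

-- Matrices as functions of two variables.

transpose : {X Y A : Setoid ℓ ℓ} → Func (X ×ₛ Y) A → Func (Y ×ₛ X) A
transpose a = record
  { to   = λ (y , x) → a ⟨$⟩ (x , y)
  ; cong = λ (e , e′) → Func.cong a (e′ , e)
  }

uncurry : {X Y A : Setoid ℓ ℓ} → Func X (Y ⇨ A) → Func (X ×ₛ Y) A
uncurry {A = A} g = record
  { to   = λ (x , y) → (g ⟨$⟩ x) ⟨$⟩ y
  ; cong = λ {(x , y)} {(x′ , y′)} (e , e′) →
      Setoid.trans A (Func.cong g e y) (Func.cong (g ⟨$⟩ x′) e′)
  }

-- Clones

module _ {𝔍 : V ℓ} {A : Setoid ℓ ℓ} where
  open Setoid A

  -- The transposed matrix exchanges the two sides. Its rows have the same values as the columns of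
  -- `a` but other congruence proofs, which the nested `refl` steps bridge.
  Commutes-sym : {X Y : Setoid ℓ ℓ} {f : Func (X ⇨ A) A} {g : Func (Y ⇨ A) A} →
                 Commutes f g → Commutes g f
  Commutes-sym {f = f} {g} c a = trans
    (Func.cong f (λ _ → Func.cong g (λ _ → refl)))
    (trans (sym (c (transpose a))) (Func.cong g (λ _ → Func.cong f (λ _ → refl))))

  ⊆⊥⊥ : (G : OperationSet 𝔍 A p) → ∀ {J f} → G J f → (G ^⊥ ^⊥) J f
  ⊆⊥⊥ G {f = f} f∈G K g g∈G⊥ = Commutes-sym {f = g} {g = f} (g∈G⊥ _ f f∈G)

  ⊥-isClone : (G : OperationSet 𝔍 A p) → IsClone (G ^⊥)
  ⊥-isClone G = record
    { respects   = λ f≋f′ f∈ L s s∈ a → trans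
        (Func.cong s (λ l → sym (f≋f′ (columns a ⟨$⟩ l))))
        (trans (f∈ L s s∈ a) (f≋f′ _))
    ; projection = λ J j L s s∈ a → Func.cong s (λ _ → refl)
    ; composite  = λ {J} {K} {f} g f∈ g∈ L s s∈ a → trans
        (Func.cong s (λ _ → Func.cong f (λ _ → refl)))
        (trans
          -- The entry at `(k , l)` is `g k` applied to column `l` of `a`. First `f` commutes with
          -- `s` on this matrix, then each `g k` does so on `a`.
          (f∈ L s s∈ (uncurry (record
            { to   = λ k → (g ⟨$⟩ k) ∘⟨ rows a ⟩
            ; cong = λ k≈k′ l → Func.cong g k≈k′ (columns a ⟨$⟩ l)
            })))
          (Func.cong f (λ k → trans (Func.cong s (λ _ → refl)) (g∈ k L s s∈ a))))
    }

-- Homomorphisms from `A^(A^J)` to `A` and the centralizer of the basic operations.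

module _ {𝔍 : V ℓ} {𝕊 : Signature 𝔍} {A : Setoid ℓ ℓ} (𝒜 : Algebra 𝕊 A) where
  open Setoid A
  open Signature 𝕊
  open Algebra 𝒜

  private
    Σᴬ = BasicOperations 𝒜

  ⟨⟩⊆⊥⊥ : ∀ {J f} → ⟨ Σᴬ ⟩ J f → (Σᴬ ^⊥ ^⊥) J f
  ⟨⟩⊆⊥⊥ = ⟨⟩-least Σᴬ (Σᴬ ^⊥ ^⊥) (⊥-isClone (Σᴬ ^⊥)) (⊆⊥⊥ Σᴬ)

  Separates : (J : Arity 𝔍) (f : Operation A J) → Homomorphism (Power 𝒜 (Els J ⇨ A)) 𝒜 → Set _
  Separates J f h =
    ¬ (Homomorphism.map h ⟨$⟩ f ≈ f ⟨$⟩ compose (projections (Els J)) (Homomorphism.map h))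

  evaluateAt : {J K : Arity 𝔍} (g : Operation A K) → (Σᴬ ^⊥) K g → Func (Els K) (Els J ⇨ A) →
               Homomorphism (Power 𝒜 (Els J ⇨ A)) 𝒜
  evaluateAt g g∈ a = record
    { map = record
        { to   = λ φ → g ⟨$⟩ compose a φ
        ; cong = λ φ≈ψ → Func.cong g (λ k → φ≈ψ (a ⟨$⟩ k))
        }
    ; preserves = λ σ φ → trans
        (Func.cong g (λ _ → Func.cong (op σ) (λ _ → refl)))
        (trans
          -- Preservation of `σ` is commutation of `g` with `op σ` on the matrix whose entry at
          -- `(k , l)` is the value of the `l`-th map of `φ` at the point `a k`.
          (sym (g∈ (ar σ) (op σ) (basic σ (λ _ → refl))
            (transpose (uncurry (record
              { to   = λ l → compose a (φ ⟨$⟩ l)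
              ; cong = λ l≈l′ k → Func.cong φ l≈l′ (a ⟨$⟩ k)
              })))))
          (Func.cong (op σ) (λ _ → Func.cong g (λ _ → refl))))
    }

  module _ {J K : Arity 𝔍} (bij : Bijection (Els J ⇨ A) (Els K))
           (h : Homomorphism (Power 𝒜 (Els J ⇨ A)) 𝒜) where
    private
      module h = Homomorphism h
      module I = Inverse (Bijection⇒Inverse bij)

      to : Func (Els J ⇨ A) (Els K)
      to = record { to = I.to ; cong = I.to-cong }

      from : Func (Els K) (Els J ⇨ A)
      from = record { to = I.from ; cong = I.from-cong }

    asOperation : Operation A K
    asOperation = record
      { to   = λ b → h.map ⟨$⟩ compose to b
      ; cong = λ b≈b′ → Func.cong h.map (λ φ → b≈b′ (I.to φ))
      }

    asOperation∈⊥ : (Σᴬ ^⊥) K asOperation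
    -- Commutation with `op σ` is preservation of `σ` by `h`; since `s` is `op σ` only up to `≋`,
    -- `e` is used on both sides.
    asOperation∈⊥ L s (basic σ e) a = trans
      (trans (sym (e _)) (Func.cong (op σ) (λ _ → Func.cong h.map (λ _ → refl))))
      (trans (sym (h.preserves σ (record
          { to   = λ l → compose to (rows (transpose a) ⟨$⟩ l)
          ; cong = λ l≈l′ y → Func.cong (columns (transpose a) ⟨$⟩ I.to y) l≈l′
          })))
        (Func.cong h.map (λ y → trans (e _) (Func.cong s (λ _ → refl)))))

    -- The test matrix has the points `from k` of `A^J` as columns, so it lists all of them.
    -- Applying `f` to the columns recovers `f`, and row `j` is the projection at `j`; commutation
    -- on this matrix is the equation that separation denies.
    Commutes⇒¬Separates : (f : Operation A J) → Commutes f asOperation → ¬ Separates J f h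
    Commutes⇒¬Separates f c sep = sep (trans
      (Func.cong h.map (λ y → Func.cong f (λ j → sym (I.strictlyInverseʳ y j))))
      (trans (c (transpose (uncurry from)))
        (Func.cong f (λ j → Func.cong h.map (λ y → I.strictlyInverseʳ y j)))))

-- The double centralizer condition and separation by homomorphisms.

corollary6p5 : ∀ {ℓ} → ExcludedMiddle (suc ℓ) →
    (κ : V ℓ) → Inaccessible κ →
    (α : V ℓ) → Regular α → StrongLimit α → α ≤ᵒ κ →
    (𝔍 : V ℓ) → (∀ J → J ∈ 𝔍 → [ κ , α ]-Small J) →
    (∀ K → Cardinal K → [ κ , α ]-Small K → K ∈ 𝔍) →
    (𝕊 : Signature 𝔍) (A : V ℓ) (𝒜 : Algebra 𝕊 (El A)) → [ κ , α ]-Small A →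
    (BasicOperations 𝒜 ^⊥ ^⊥ ≗ ⟨ BasicOperations 𝒜 ⟩)
    ⇔
    (∀ J (f : Operation (El A) J) → ¬ ⟨ BasicOperations 𝒜 ⟩ J f →
      Σ[ h ∈ Homomorphism (Power 𝒜 (Els J ⇨ El A)) 𝒜 ]
        ¬ Setoid._≈_ (El A)
            (Homomorphism.map h ⟨$⟩ f)
            (f ⟨$⟩ compose (projections (Els J)) (Homomorphism.map h)))
corollary6p5 {ℓ} em κ inaccessible α _ strongLimit α≤κ 𝔍 𝔍-small cardinal∈𝔍 𝕊 A 𝒜 A-small =
  mk⇔ separate complete
  where
  open Classical em using (module Cardinality)
  open Cardinality α strongLimit using (∣⇨∣<)
  module A = Setoid (El A)

  Σᴬ : OperationSet 𝔍 (El A) (suc ℓ)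
  Σᴬ = BasicOperations 𝒜

  separate : (Σᴬ ^⊥ ^⊥ ≗ ⟨ Σᴬ ⟩) → ∀ J (f : Operation (El A) J) → ¬ ⟨ Σᴬ ⟩ J f →
             Σ[ h ∈ Homomorphism (Power 𝒜 (Els J ⇨ El A)) 𝒜 ] Separates 𝒜 J f h
  -- Without a separating homomorphism `f` commutes with every `g` in the centralizer, for
  -- evaluation at the columns of a failing matrix would separate. So `f` is derived, a
  -- contradiction.
  separate closed J f f∉ = em⇒dne em λ ¬h → f∉ (Equivalence.to (closed J f) λ K g g∈ a →
    lower (em⇒dne em {Lift (suc ℓ) _} λ ¬eq → ¬h
      ( evaluateAt 𝒜 {J} {K} g g∈ (columns a)
      , λ eq → ¬eq (lift (A.trans (Func.cong g (λ _ → Func.cong f (λ _ → A.refl)))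
          (A.trans eq (Func.cong f (λ _ → Func.cong g (λ _ → A.refl)))))))))

  -- A cardinal is its own rank, so `α ≤ᵒ κ` bounds that rank by κ. This makes the cardinal of `A^J`
  -- available as an arity.
  small-cardinal : ∀ K → Cardinal K → K ∈ α → [ κ , α ]-Small K
  small-cardinal K card K∈α = record
    { small = ∈-respˡ (rank K) K κ (rank-ordinal K (proj₁ card)) (K∈κ α≤κ)
    ; card< = Cardinal⇒∣∣< α K card K∈α
    }
    where
    κ-transitive : TransitiveSet κ
    κ-transitive = proj₁ (proj₁ (Regular.cardinal (Inaccessible.regular inaccessible)))

    K∈κ : α ≤ᵒ κ → K ∈ κ
    K∈κ (inj₁ α∈κ) = κ-transitive α α∈κ K K∈α
    K∈κ (inj₂ α≐κ) = ≐⇒⊆ α κ α≐κ K K∈α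

  complete : (∀ J (f : Operation (El A) J) → ¬ ⟨ Σᴬ ⟩ J f →
               Σ[ h ∈ Homomorphism (Power 𝒜 (Els J ⇨ El A)) 𝒜 ] Separates 𝒜 J f h) →
             Σᴬ ^⊥ ^⊥ ≗ ⟨ Σᴬ ⟩
  complete separating J@(arity x x∈𝔍) f = mk⇔ ⊥⊥⊆⟨⟩ (⟨⟩⊆⊥⊥ 𝒜)
    where
    ⊥⊥⊆⟨⟩ : (Σᴬ ^⊥ ^⊥) J f → ⟨ Σᴬ ⟩ J f
    ⊥⊥⊆⟨⟩ f∈⊥⊥ = em⇒dne em λ f∉ →
      let h , sep = separating J f f∉
          K , card , K∈α , bij =
            ∣⇨∣< ([_,_]-Small.card< (𝔍-small x x∈𝔍)) ([_,_]-Small.card< A-small)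
          K′ = arity K (cardinal∈𝔍 K card (small-cardinal K card K∈α))
      in Commutes⇒¬Separates 𝒜 {J} {K′} bij h f
           (f∈⊥⊥ K′ (asOperation 𝒜 {J} {K′} bij h) (asOperation∈⊥ 𝒜 {J} {K′} bij h)) sep
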